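{- Let $G$ be a simple graph which either has at least three vertices (connected or not) or is the disconnected graph on two vertices. Then $\pi_s(G) = \pi(G)$, where $\pi(G)$ is the pebbling number and $\pi_s(G)$ is the singular pebbling number of $G$ (both values may be $\infty$, in which case the equality means that both are infinite).
   Context: All graphs are simple (no loops and no multiple edges). A configuration of $t$ pebbles on $G$ is a function $C : V(G) \to \{0,1,2,\dots\}$ with $\sum_{v} C(v) = t$; $C(v)$ is the number of pebbles on $v$. A pebbling move consists of choosing a vertex $u$ carrying at least two pebbles and a vertex $v$ adjacent to $u$, taking two pebbles off $u$, placing one of them on $v$ and removing the other from the game. Pebbling moves are applied in finite (possibly empty) sequences. The pebbling number $\pi(G)$ is the smallest $t$ such that, for every configuration of $t$ pebbles on $G$ and every vertex $r$ (the target vertex), there is a finite sequence of pebbling moves after which at least one pebble is on $r$. If no such $t$ exists, $\pi(G) = \infty$. The singular pebbling number $\pi_s(G)$ is the smallest $t$ such that, for every configuration of at least $t$ pebbles on $G$ and every target vertex $r$, there is a finite sequence of pebbling moves after which exactly one pebble is on $r$. If no such $t$ exists, $\pi_s(G) = \infty$. -}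

module Defs where

open import Data.Fin using (Fin)
open import Data.Nat using (ℕ; suc; _∸_; _≤_)
open import Data.Product using (_×_; ∃-syntax)
open import Data.Vec using (Vec; lookup; sum; _[_]%=_)
open import Relation.Binary.Construct.Closure.ReflexiveTransitive using (Star)
open import Relation.Binary.Core using (Rel)
open import Relation.Binary.Definitions using (Symmetric; Irreflexive; Decidable)
open import Relation.Binary.PropositionalEquality using (_≡_)
open import Relation.Nullary using (¬_)
open import Relation.Nullary.Construct.Add.Supremum using (_⁺; [_]; ⊤⁺)
open import Level using (0ℓ)

-- Decidability of adjacency holds classically for every graph; recording it
-- loses no graphs.
record SimpleGraph (n : ℕ) : Set₁ where
  field
    Adj    : Rel (Fin n) 0ℓ
    sym    : Symmetric Adj
    irrefl : Irreflexive _≡_ Adj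
    adj?   : Decidable Adj

open SimpleGraph public using (Adj)

Connected : ∀ {n} → SimpleGraph n → Set
Connected G = ∀ u v → Star (Adj G) u v

-- A function Fin n → ℕ, stored as its table of values so that pointwise equal
-- configurations are propositionally equal.
Configuration : ℕ → Set
Configuration n = Vec ℕ n

-- Since Adj is irreflexive, u and v are distinct, so the two updates do not
-- interfere; the hypothesis 2 ≤ lookup C u makes the subtraction exact.
data Move {n} (G : SimpleGraph n) : Rel (Configuration n) 0ℓ where
  move : ∀ {C} u v → 2 ≤ lookup C u → Adj G u v →
         Move G C (C [ u ]%= (_∸ 2) [ v ]%= suc)

Moves : ∀ {n} → SimpleGraph n → Rel (Configuration n) 0ℓ
Moves G = Star (Move G)

Solves : ∀ {n} → SimpleGraph n → ℕ → Set
Solves {n} G t = ∀ (C : Configuration n) → sum C ≡ t → ∀ r →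
  ∃[ D ] Moves G C D × 1 ≤ lookup D r

SinglySolves : ∀ {n} → SimpleGraph n → ℕ → Set
SinglySolves {n} G t = ∀ (C : Configuration n) → t ≤ sum C → ∀ r →
  ∃[ D ] Moves G C D × lookup D r ≡ 1

ℕ∞ : Set
ℕ∞ = ℕ ⁺

pattern ∞ = ⊤⁺

-- x is the smallest number satisfying P, with x = ∞ when there is none. This
-- determines x uniquely. It is a relation and not a function of P because the
-- minimum of an arbitrary predicate on ℕ is not computable.
IsSmallest : (ℕ → Set) → ℕ∞ → Set
IsSmallest P [ t ] = P t × (∀ s → P s → t ≤ s)
IsSmallest P ∞     = ∀ t → ¬ P t

IsPebblingNumber : ∀ {n} → SimpleGraph n → ℕ∞ → Set
IsPebblingNumber G = IsSmallest (Solves G)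

IsSingularPebblingNumber : ∀ {n} → SimpleGraph n → ℕ∞ → Set
IsSingularPebblingNumber G = IsSmallest (SinglySolves G)

{-# OPTIONS --safe #-}

-- Solves and SinglySolves coincide at every t. Let C have at least t pebbles
-- and let r be the target. If r is empty, it carries exactly one pebble the
-- first time it is reached. If r has at least two, moving pairs between r and
-- a neighbour succeeds unless r has exactly two and all its neighbours are
-- empty. In that case suppose first that some w ≠ r is not adjacent to r.
-- Relocating the two pebbles of r to w gives a configuration that puts two
-- pebbles on some neighbour v of r. Deleting two pebbles from w costs at most
-- one pebble elsewhere (once they move they are only one pebble), so C
-- without the pebbles of r still puts a pebble on v, and a move r → v then
-- puts two there, one of which returns to r. If instead every other vertex is
-- adjacent to r, then C has only two pebbles, which is fewer than t.
module Submission where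

open import Algebra.Properties.CommutativeSemigroup using (x∙yz≈y∙xz)
open import Data.Empty using (⊥-elim)
open import Data.Fin using (Fin; zero; suc)
open import Data.Fin.Properties using (_≟_; any?)
open import Data.Nat using (ℕ; zero; suc; _+_; _*_; _∸_; _⊓_; _≤_; _≤?_; z≤n; s≤s)
open import Data.Nat.Properties hiding (_≟_)
open import Data.Product using (_×_; _,_; ∃-syntax)
open import Data.Sum using (_⊎_; inj₁; inj₂)
open import Data.Vec using ([]; _∷_; lookup; sum; replicate; _[_]%=_)
open import Data.Vec.Properties using (lookup∘updateAt; lookup∘updateAt′; lookup-replicate)
open import Function using (const; _∘_)
open import Function.Bundles using (_⇔_; mk⇔)
open import Relation.Binary.Construct.Closure.ReflexiveTransitive using (ε; _◅_; _◅◅_)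
open import Relation.Binary.PropositionalEquality
  using (_≡_; _≢_; refl; sym; trans; cong; cong₂; subst; module ≡-Reasoning)
open import Relation.Nullary using (¬_; yes; no; ¬?; contradiction)
open import Relation.Nullary.Construct.Add.Supremum using ([_])
open import Relation.Nullary.Decidable using (_×-dec_)
open import Defs

private
  variable
    n : ℕ

-- Pebble counts under a change at one vertex.

δ : Fin n → Fin n → ℕ
δ x i with x ≟ i
... | yes _ = 1
... | no  _ = 0

δ≤1 : (x i : Fin n) → δ x i ≤ 1
δ≤1 x i with x ≟ i
... | yes _ = ≤-refl
... | no  _ = z≤n

δ-diag : (x : Fin n) → δ x x ≡ 1
δ-diag x with x ≟ x
... | yes _   = refl
... | no  x≢x = contradiction refl x≢x

δ-off : {x i : Fin n} → x ≢ i → δ x i ≡ 0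
δ-off {x = x} {i} x≢i with x ≟ i
... | yes x≡i = contradiction x≡i x≢i
... | no  _   = refl

+-left-comm : ∀ a b c → a + (b + c) ≡ b + (a + c)
+-left-comm = x∙yz≈y∙xz +-commutativeSemigroup

lookup-add : ∀ k (C : Configuration n) x i →
  lookup (C [ x ]%= (k +_)) i ≡ k * δ x i + lookup C i
lookup-add k C x i with x ≟ i
... | yes refl = trans (lookup∘updateAt x C) (cong (_+ lookup C x) (sym (*-identityʳ k)))
... | no x≢i   = trans (lookup∘updateAt′ i x (x≢i ∘ sym) C)
                       (cong (_+ lookup C i) (sym (*-zeroʳ k)))

lookup-remove : ∀ k (C : Configuration n) x i → k ≤ lookup C x →
  k * δ x i + lookup (C [ x ]%= (_∸ k)) i ≡ lookup C i
lookup-remove k C x i k≤ with x ≟ i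
... | yes refl = trans (cong₂ _+_ (*-identityʳ k) (lookup∘updateAt x C)) (m+[n∸m]≡n k≤)
... | no x≢i   = cong₂ _+_ (*-zeroʳ k) (lookup∘updateAt′ i x (x≢i ∘ sym) C)

-- Each side counts the old entry, the new entry and the rest. The additive form lets adding and
-- removing pebbles both follow by cancellation.
sum-update : ∀ (C : Configuration n) x f →
  lookup C x + sum (C [ x ]%= f) ≡ f (lookup C x) + sum C
sum-update (c ∷ C) zero    f = +-left-comm c (f c) (sum C)
sum-update (c ∷ C) (suc x) f = begin
  lookup C x + (c + sum (C [ x ]%= f)) ≡⟨ +-left-comm (lookup C x) c _ ⟩
  c + (lookup C x + sum (C [ x ]%= f)) ≡⟨ cong (c +_) (sum-update C x f) ⟩
  c + (f (lookup C x) + sum C)         ≡⟨ +-left-comm c (f (lookup C x)) _ ⟩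
  f (lookup C x) + (c + sum C)         ∎
  where open ≡-Reasoning

sum-add : ∀ k (C : Configuration n) x → sum (C [ x ]%= (k +_)) ≡ k + sum C
sum-add k C x = +-cancelˡ-≡ (lookup C x) _ _ (begin
  lookup C x + sum (C [ x ]%= (k +_)) ≡⟨ sum-update C x (k +_) ⟩
  k + lookup C x + sum C              ≡⟨ +-assoc k _ _ ⟩
  k + (lookup C x + sum C)            ≡⟨ +-left-comm k (lookup C x) _ ⟩
  lookup C x + (k + sum C)            ∎)
  where open ≡-Reasoning

sum-remove : ∀ k (C : Configuration n) x → k ≤ lookup C x →
  k + sum (C [ x ]%= (_∸ k)) ≡ sum C
sum-remove k C x k≤ = +-cancelˡ-≡ (lookup C x) _ _ (begin
  lookup C x + (k + sum C′)         ≡⟨ +-left-comm (lookup C x) k _ ⟩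
  k + (lookup C x + sum C′)         ≡⟨ cong (k +_) (sum-update C x (_∸ k)) ⟩
  k + ((lookup C x ∸ k) + sum C)    ≡⟨ +-assoc k _ _ ⟨
  k + (lookup C x ∸ k) + sum C      ≡⟨ cong (_+ sum C) (m+[n∸m]≡n k≤) ⟩
  lookup C x + sum C                ∎)
  where
  open ≡-Reasoning
  C′ = C [ x ]%= (_∸ k)

sum-empty : (C : Configuration n) → (∀ i → lookup C i ≡ 0) → sum C ≡ 0
sum-empty []      _     = refl
sum-empty (c ∷ C) empty = cong₂ _+_ (empty zero) (sum-empty C (empty ∘ suc))

subconfiguration : ∀ (C : Configuration n) {t} → t ≤ sum C →
  ∃[ B ] sum B ≡ t × (∀ i → lookup B i ≤ lookup C i)
subconfiguration []      z≤n = [] , refl , λ ()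
subconfiguration (c ∷ C) {t} t≤
  with B , sumB , B≤C ← subconfiguration C (m≤n+o⇒m∸n≤o t c t≤) =
  -- Greedy choice: this vertex gives as much as is wanted, and the tail supplies the remaining
  -- `t ∸ c`.
  c ⊓ t ∷ B ,
  trans (cong ((c ⊓ t) +_) sumB) (m⊓n+n∸m≡n c t) ,
  λ { zero → m⊓n≤m c t ; (suc i) → B≤C i }

-- Pebbling moves and their imitation in a comparable configuration.

module _ (G : SimpleGraph n) where

  after : Configuration n → Fin n → Fin n → Configuration n
  after C u v = C [ u ]%= (_∸ 2) [ v ]%= suc

  Adj-sym : ∀ {u v} → Adj G u v → Adj G v u
  Adj-sym = SimpleGraph.sym G

  Adj⇒≢ : ∀ {u v} → Adj G u v → u ≢ v
  Adj⇒≢ u~v refl = SimpleGraph.irrefl G refl u~v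

  -- The effect of a move, with the removal on the left to avoid subtraction.
  after-balance : ∀ C u v i → 2 ≤ lookup C u →
    2 * δ u i + lookup (after C u v) i ≡ δ v i + lookup C i
  after-balance C u v i 2≤ = begin
    2 * δ u i + lookup (after C u v) i   ≡⟨ cong (2 * δ u i +_) (lookup-add 1 C′ v i) ⟩
    2 * δ u i + (1 * δ v i + lookup C′ i) ≡⟨ cong (λ d → 2 * δ u i + (d + lookup C′ i)) (*-identityˡ (δ v i)) ⟩
    2 * δ u i + (δ v i + lookup C′ i)    ≡⟨ +-left-comm (2 * δ u i) (δ v i) _ ⟩
    δ v i + (2 * δ u i + lookup C′ i)    ≡⟨ cong (δ v i +_) (lookup-remove 2 C u i 2≤) ⟩
    δ v i + lookup C i                   ∎
    where
    open ≡-Reasoning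
    C′ = C [ u ]%= (_∸ 2)

  after-source : ∀ C {u v} → u ≢ v → lookup (after C u v) u ≡ lookup C u ∸ 2
  after-source C {u} {v} u≢v =
    trans (lookup∘updateAt′ u v u≢v (C [ u ]%= (_∸ 2))) (lookup∘updateAt u C)

  after-dest : ∀ C {u v} → u ≢ v → lookup (after C u v) v ≡ suc (lookup C v)
  after-dest C {u} {v} u≢v =
    trans (lookup∘updateAt v (C [ u ]%= (_∸ 2)))
          (cong suc (lookup∘updateAt′ v u (u≢v ∘ sym) C))

  -- The move changes both sides equally at every vertex. `e` is a reserve that `C` holds beyond
  -- `B`, `f` a shortage that it may have.
  move-simulates : ∀ (e f : Fin n → ℕ) B C u v → 2 ≤ lookup B u → 2 ≤ lookup C u →
    (∀ i → e i + lookup B i ≤ f i + lookup C i) →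
    ∀ i → e i + lookup (after B u v) i ≤ f i + lookup (after C u v) i
  move-simulates e f B C u v 2≤B 2≤C B≤C i = +-cancelˡ-≤ (2 * δ u i) _ _ (begin
    2 * δ u i + (e i + lookup (after B u v) i) ≡⟨ +-left-comm (2 * δ u i) (e i) _ ⟩
    e i + (2 * δ u i + lookup (after B u v) i) ≡⟨ cong (e i +_) (after-balance B u v i 2≤B) ⟩
    e i + (δ v i + lookup B i)                 ≡⟨ +-left-comm (e i) (δ v i) _ ⟩
    δ v i + (e i + lookup B i)                 ≤⟨ +-monoʳ-≤ (δ v i) (B≤C i) ⟩
    δ v i + (f i + lookup C i)                 ≡⟨ +-left-comm (δ v i) (f i) _ ⟩
    f i + (δ v i + lookup C i)                 ≡⟨ cong (f i +_) (after-balance C u v i 2≤C) ⟨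
    f i + (2 * δ u i + lookup (after C u v) i) ≡⟨ +-left-comm (f i) (2 * δ u i) _ ⟩
    2 * δ u i + (f i + lookup (after C u v) i) ∎)
    where open ≤-Reasoning

  -- The imitated moves never touch the reserve `e`; `reachesOne-two` uses this to keep two pebbles
  -- on the target.
  moves-mono : ∀ (e : Fin n → ℕ) {B C E} → (∀ i → e i + lookup B i ≤ lookup C i) →
    Moves G B E → ∃[ F ] Moves G C F × (∀ i → e i + lookup E i ≤ lookup F i)
  moves-mono e {C = C} B≤C ε = C , ε , B≤C
  moves-mono e {B} {C} B≤C (move u v 2≤B u~v ◅ ms)
    with 2≤C ← ≤-trans 2≤B (≤-trans (m≤n+m (lookup B u) (e u)) (B≤C u))
    with F , ms′ , E≤F ← moves-mono e (move-simulates e (const 0) B C u v 2≤B 2≤C B≤C) ms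
    = F , move u v 2≤C u~v ◅ ms′ , E≤F

  -- If a move from u cannot be imitated, u is the vertex x where C is short of
  -- pebbles; omitting the move shifts the shortage, reduced to 1, to v.
  move-omitted : ∀ k B C x u v → k ≤ 2 → 2 ≤ lookup B u → ¬ 2 ≤ lookup C u →
    (∀ i → lookup B i ≤ k * δ x i + lookup C i) →
    ∀ i → lookup (after B u v) i ≤ 1 * δ v i + lookup C i
  move-omitted k B C x u v k≤2 2≤B 2≰C B≤C i with x ≟ u
  ... | no x≢u = contradiction
    (≤-trans 2≤B (≤-trans (B≤C u)
      (≤-reflexive (cong (_+ lookup C u) (trans (cong (k *_) (δ-off x≢u)) (*-zeroʳ k))))))
    2≰C
  ... | yes refl = +-cancelˡ-≤ (2 * δ x i) _ _ (begin
    2 * δ x i + lookup (after B x v) i       ≡⟨ after-balance B x v i 2≤B ⟩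
    δ v i + lookup B i                       ≤⟨ +-monoʳ-≤ (δ v i) (B≤C i) ⟩
    δ v i + (k * δ x i + lookup C i)         ≤⟨ +-monoʳ-≤ (δ v i) (+-monoˡ-≤ _ (*-monoˡ-≤ (δ x i) k≤2)) ⟩
    δ v i + (2 * δ x i + lookup C i)         ≡⟨ +-left-comm (δ v i) (2 * δ x i) _ ⟩
    2 * δ x i + (δ v i + lookup C i)         ≡⟨ cong (λ d → 2 * δ x i + (d + lookup C i)) (*-identityˡ (δ v i)) ⟨
    2 * δ x i + (1 * δ v i + lookup C i)     ∎)
    where open ≤-Reasoning

  -- The shortage of one pebble never grows but may wander: omitting a move that `C` cannot make
  -- passes it on to the destination of that move, hence the existential `y`.
  moves-without-one : ∀ x {B C E} → (∀ i → lookup B i ≤ 1 * δ x i + lookup C i) →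
    Moves G B E →
    ∃[ y ] ∃[ F ] Moves G C F × (∀ i → lookup E i ≤ 1 * δ y i + lookup F i)
  moves-without-one x {C = C} B≤C ε = x , C , ε , B≤C
  moves-without-one x {B} {C} B≤C (move u v 2≤B u~v ◅ ms) with 2 ≤? lookup C u
  ... | no 2≰C =
    moves-without-one v (move-omitted 1 B C x u v (s≤s z≤n) 2≤B 2≰C B≤C) ms
  ... | yes 2≤C
    with y , F , ms′ , E≤F ← moves-without-one x
      (move-simulates (const 0) (λ i → 1 * δ x i) B C u v 2≤B 2≤C B≤C) ms
    = y , F , move u v 2≤C u~v ◅ ms′ , E≤F

  -- While every move is imitated, the shortage stays at `x`, away from `v`. The first omitted move
  -- turns two missing pebbles into one, so from then on `v` lacks at most one.
  moves-without-two : ∀ x {B C E} → (∀ i → lookup B i ≤ 2 * δ x i + lookup C i) →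
    Moves G B E → ∀ v → x ≢ v → 2 ≤ lookup E v →
    ∃[ F ] Moves G C F × 1 ≤ lookup F v
  moves-without-two x {C = C} B≤C ε v x≢v 2≤E =
    C , ε , ≤-trans (s≤s z≤n) (≤-trans 2≤E (≤-trans (B≤C v)
      (≤-reflexive (cong (λ d → 2 * d + lookup C v) (δ-off x≢v)))))
  moves-without-two x {B} {C} B≤C (move a b 2≤B a~b ◅ ms) v x≢v 2≤E with 2 ≤? lookup C a
  ... | no 2≰C
    with y , F , ms′ , E≤F ← moves-without-one b
      (move-omitted 2 B C x a b ≤-refl 2≤B 2≰C B≤C) ms
    = F , ms′ , +-cancelˡ-≤ 1 _ _ (≤-trans 2≤E (≤-trans (E≤F v)
        (+-monoˡ-≤ (lookup F v) (*-monoʳ-≤ 1 (δ≤1 y v)))))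
  ... | yes 2≤C
    with F , ms′ , 1≤F ← moves-without-two x
      (move-simulates (const 0) (λ i → 2 * δ x i) B C a b 2≤B 2≤C B≤C) ms v x≢v 2≤E
    = F , move a b 2≤C a~b ◅ ms′ , 1≤F

  -- The sequence is cut just before its first move into `r`, whose source is the required
  -- neighbour. Until then `r` stays empty, as only a move into it raises its count.
  before-first-arrival : ∀ {C D} r → lookup C r ≡ 0 → Moves G C D → 1 ≤ lookup D r →
    ∃[ E ] ∃[ v ] Moves G C E × Adj G v r × 2 ≤ lookup E v
  before-first-arrival r Cr≡0 ε 1≤Dr = contradiction Cr≡0 (m<n⇒n≢0 1≤Dr)
  before-first-arrival {C} r Cr≡0 (move u v 2≤C u~v ◅ ms) 1≤Dr with v ≟ r
  ... | yes refl = C , u , ε , u~v , 2≤C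
  ... | no v≢r
    with E , w , ms′ , w~r , 2≤E ← before-first-arrival r
      (m+n≡0⇒n≡0 (2 * δ u r)
        (trans (after-balance C u v r 2≤C) (cong₂ _+_ (δ-off v≢r) Cr≡0)))
      ms 1≤Dr
    = E , w , move u v 2≤C u~v ◅ ms′ , w~r , 2≤E

  -- Leaving exactly one pebble on the target.

  ReachesOne : Configuration n → Fin n → Set
  ReachesOne C r = ∃[ D ] Moves G C D × lookup D r ≡ 1

  reachesOne-via : ∀ {B C r} → Moves G B C → ReachesOne C r → ReachesOne B r
  reachesOne-via ms (D , ms′ , Dr≡1) = D , ms ◅◅ ms′ , Dr≡1

  -- Moves from `r` to `v` lower `r` by two and only add to the pair on `v`. At 1 the goal is met;
  -- at 0 the pair on `v` supplies the pebble.
  reachesOne-pair-at-neighbour : ∀ k C r v → lookup C r ≡ k → Adj G v r →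
    2 ≤ lookup C v → ReachesOne C r
  reachesOne-pair-at-neighbour 0 C r v Cr≡0 v~r 2≤Cv =
    after C v r , move v r 2≤Cv v~r ◅ ε ,
    trans (after-dest C (Adj⇒≢ v~r)) (cong suc Cr≡0)
  reachesOne-pair-at-neighbour 1 C r v Cr≡1 v~r 2≤Cv = C , ε , Cr≡1
  reachesOne-pair-at-neighbour (suc (suc k)) C r v Cr≡2+k v~r 2≤Cv =
    reachesOne-via (move r v 2≤Cr r~v ◅ ε)
      (reachesOne-pair-at-neighbour k (after C r v) r v
        (trans (after-source C (Adj⇒≢ r~v)) (cong (_∸ 2) Cr≡2+k)) v~r
        (subst (2 ≤_) (sym (after-dest C (Adj⇒≢ r~v))) (m≤n⇒m≤1+n 2≤Cv)))
    where
    r~v = Adj-sym v~r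
    2≤Cr : 2 ≤ lookup C r
    2≤Cr = subst (2 ≤_) (sym Cr≡2+k) (s≤s (s≤s z≤n))

  reachesOne-occupied-neighbour : ∀ C r v → Adj G v r → 2 ≤ lookup C r →
    1 ≤ lookup C v → ReachesOne C r
  reachesOne-occupied-neighbour C r v v~r 2≤Cr 1≤Cv =
    reachesOne-via (move r v 2≤Cr r~v ◅ ε)
      (reachesOne-pair-at-neighbour _ (after C r v) r v refl v~r
        (subst (2 ≤_) (sym (after-dest C (Adj⇒≢ r~v))) (s≤s 1≤Cv)))
    where r~v = Adj-sym v~r

  -- Here `v` may be empty. The first move leaves `r` occupied, so either one pebble remains there
  -- or `v` has become an occupied neighbour of a vertex with a pair. From only two pebbles this
  -- move would empty `r`.
  reachesOne-three : ∀ k C r v → lookup C r ≡ 3 + k → Adj G v r → ReachesOne C r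
  reachesOne-three k C r v Cr≡3+k v~r = reachesOne-via (move r v 2≤Cr r~v ◅ ε) (rest k source)
    where
    r~v = Adj-sym v~r
    2≤Cr : 2 ≤ lookup C r
    2≤Cr = subst (2 ≤_) (sym Cr≡3+k) (s≤s (s≤s z≤n))
    source : lookup (after C r v) r ≡ suc k
    source = trans (after-source C (Adj⇒≢ r~v)) (cong (_∸ 2) Cr≡3+k)
    rest : ∀ k → lookup (after C r v) r ≡ suc k → ReachesOne (after C r v) r
    rest zero    eq = after C r v , ε , eq
    rest (suc k) eq = reachesOne-occupied-neighbour (after C r v) r v v~r
      (subst (2 ≤_) (sym eq) (s≤s (s≤s z≤n)))
      (subst (1 ≤_) (sym (after-dest C (Adj⇒≢ r~v))) (s≤s z≤n))

  -- Consequences of solvability.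

  solves-mono : ∀ {s t} → s ≤ t → Solves G s → Solves G t
  solves-mono s≤t solves C sumC r
    with B , sumB , B≤C ← subconfiguration C (≤-trans s≤t (≤-reflexive (sym sumC)))
    with D , ms , 1≤Dr ← solves B sumB r
    with F , ms′ , D≤F ← moves-mono (const 0) B≤C ms
    = F , ms′ , ≤-trans 1≤Dr (D≤F r)

  approach : ∀ {t} → Solves G t → ∀ C r → t ≤ sum C → lookup C r ≡ 0 →
    ∃[ E ] ∃[ v ] Moves G C E × Adj G v r × 2 ≤ lookup E v
  approach solves C r t≤C Cr≡0
    with D , ms , 1≤Dr ← solves-mono t≤C solves C refl r
    = before-first-arrival r Cr≡0 ms 1≤Dr

  -- With all `t` pebbles on `s`, the target starts empty and can be reached only through a
  -- neighbour.
  solves⇒neighbour : ∀ {t} → Solves G t → ∀ {r s} → s ≢ r → ∃[ v ] Adj G v r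
  solves⇒neighbour {t} solves {r} {s} s≢r =
    let empty = replicate n 0
        _ , v , _ , v~r , _ = approach solves (empty [ s ]%= (t +_)) r
          (subst (t ≤_) (sym (sum-add t empty s)) (m≤m+n t _))
          (trans (lookup∘updateAt′ r s (s≢r ∘ sym) empty) (lookup-replicate r 0))
    in v , v~r

  reachesOne-two : ∀ {t} → Solves G t → ∀ C r w → t ≤ sum C → lookup C r ≡ 2 →
    w ≢ r → ¬ Adj G w r → ReachesOne C r
  reachesOne-two {t} solves C r w t≤C Cr≡2 w≢r w≁r =
    -- `W` has the two pebbles of `r` relocated to `w`; `D` lacks them altogether. As `v` is
    -- adjacent to `r` and `w` is not, the shortage at `w` is not at `v`.
    let E , v , ms , v~r , 2≤E = approach solves W r t≤W Wr≡0
        F , ms′ , 1≤F = moves-without-two w {C = D} (λ i → ≤-reflexive (lookup-add 2 D w i)) ms v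
          (λ w≡v → w≁r (subst (λ u → Adj G u r) (sym w≡v) v~r)) 2≤E
        -- The moves found for `D` are replayed in `C` with the pair on `r` in reserve, ending with
        -- at least two pebbles on `r` and one on `v`.
        H , ms″ , F≤H = moves-mono (λ i → 2 * δ r i) {C = C}
          (λ i → ≤-reflexive (lookup-remove 2 C r i 2≤Cr)) ms′
    in reachesOne-via ms″ (reachesOne-occupied-neighbour H r v v~r
        (≤-trans (≤-trans (≤-reflexive (sym (cong (2 *_) (δ-diag r)))) (m≤m+n _ _)) (F≤H r))
        (≤-trans 1≤F (≤-trans (m≤n+m _ _) (F≤H v))))
    where
    D = C [ r ]%= (_∸ 2)
    W = D [ w ]%= (2 +_)
    2≤Cr : 2 ≤ lookup C r
    2≤Cr = ≤-reflexive (sym Cr≡2)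
    t≤W : t ≤ sum W
    t≤W = subst (t ≤_) (sym (trans (sum-add 2 D w) (sum-remove 2 C r 2≤Cr))) t≤C
    Wr≡0 : lookup W r ≡ 0
    Wr≡0 = trans (lookup∘updateAt′ r w (w≢r ∘ sym) D)
                 (trans (lookup∘updateAt r C) (cong (_∸ 2) Cr≡2))

  concentrated-sum : ∀ (C : Configuration n) r → lookup C r ≡ 2 →
    (∀ i → r ≢ i → lookup C i ≡ 0) → sum C ≡ 2
  concentrated-sum C r Cr≡2 C≡0 = begin
    sum C                            ≡⟨ sum-remove 2 C r (≤-reflexive (sym Cr≡2)) ⟨
    2 + sum (C [ r ]%= (_∸ 2))       ≡⟨ cong (2 +_) (sum-empty (C [ r ]%= (_∸ 2)) vanishes) ⟩
    2                                ∎
    where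
    open ≡-Reasoning
    vanishes : ∀ i → lookup (C [ r ]%= (_∸ 2)) i ≡ 0
    vanishes i with r ≟ i
    ... | yes refl = trans (lookup∘updateAt r C) (cong (_∸ 2) Cr≡2)
    ... | no r≢i   = trans (lookup∘updateAt′ i r (r≢i ∘ sym) C) (C≡0 i r≢i)

  solves⇒singlySolves : ∀ {t} → Solves G t → ¬ Solves G 2 →
    (∀ r → ∃[ s ] s ≢ r) → SinglySolves G t
  solves⇒singlySolves {t} solves ¬solves₂ other C t≤C r = go _ refl
    where
    go : ∀ k → lookup C r ≡ k → ReachesOne C r
    go 0 Cr≡0 with E , v , ms , v~r , 2≤E ← approach solves C r t≤C Cr≡0 =
      reachesOne-via ms (reachesOne-pair-at-neighbour _ E r v refl v~r 2≤E)
    go 1 Cr≡1 = C , ε , Cr≡1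
    go 2 Cr≡2
      with any? (λ v → SimpleGraph.adj? G v r ×-dec (1 ≤? lookup C v))
    ... | yes (v , v~r , 1≤Cv) =
      reachesOne-occupied-neighbour C r v v~r (≤-reflexive (sym Cr≡2)) 1≤Cv
    ... | no ∄occupied
      with any? (λ w → ¬? (w ≟ r) ×-dec ¬? (SimpleGraph.adj? G w r))
    ... | yes (w , w≢r , w≁r) = reachesOne-two solves C r w t≤C Cr≡2 w≢r w≁r
    -- All pebbles lie on `r`, so `t ≤ 2`, and solvability would pass from `t` up to 2.
    ... | no ∄distant = contradiction (solves-mono t≤2 solves) ¬solves₂
      where
      C≡0 : ∀ i → r ≢ i → lookup C i ≡ 0
      -- An occupied `i` would be a neighbour, against `∄occupied`, or a non-neighbour, against
      -- `∄distant`.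
      C≡0 i r≢i = n<1⇒n≡0 (≰⇒> λ 1≤Ci →
        ∄distant (i , r≢i ∘ sym , λ i~r → ∄occupied (i , i~r , 1≤Ci)))
      t≤2 : t ≤ 2
      t≤2 = subst (t ≤_) (concentrated-sum C r Cr≡2 C≡0) t≤C
    go (suc (suc (suc k))) eq
      with s , s≢r ← other r
      with v , v~r ← solves⇒neighbour solves s≢r
      = reachesOne-three k C r v eq v~r

  singlySolves⇒solves : ∀ {t} → SinglySolves G t → Solves G t
  singlySolves⇒solves singly C sumC r
    with D , ms , Dr≡1 ← singly C (≤-reflexive (sym sumC)) r
    = D , ms , ≤-reflexive (sym Dr≡1)

-- Single pebbles on two vertices different from the target admit no move.
¬solves-two : (G : SimpleGraph (3 + n)) → ¬ Solves G 2
¬solves-two {n} G solves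
  with solves (0 ∷ 1 ∷ 1 ∷ replicate n 0)
         (cong (2 +_) (sum-empty (replicate n 0) (λ i → lookup-replicate i 0))) zero
... | D , move u v 2≤C u~v ◅ ms , _ = <⇒≱ 2≤C (atMostOne u)
  where
  atMostOne : ∀ u → lookup (0 ∷ 1 ∷ 1 ∷ replicate n 0) u ≤ 1
  atMostOne zero                = z≤n
  atMostOne (suc zero)          = ≤-refl
  atMostOne (suc (suc zero))    = ≤-refl
  atMostOne (suc (suc (suc i))) = ≤-trans (≤-reflexive (lookup-replicate i 0)) z≤n

another-vertex : (r : Fin (2 + n)) → ∃[ s ] s ≢ r
another-vertex zero    = suc zero , λ ()
another-vertex (suc r) = zero , λ ()

-- Solvability gives `zero` a neighbour, which can only be the other vertex, and this one edge
-- connects the graph.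
solves⇒connected : (G : SimpleGraph 2) → ∀ {t} → Solves G t → Connected G
solves⇒connected G solves with solves⇒neighbour G solves {zero} {suc zero} (λ ())
... | zero     , 0~0 = ⊥-elim (SimpleGraph.irrefl G refl 0~0)
... | suc zero , 1~0 = λ where
  zero       zero       → ε
  zero       (suc zero) → SimpleGraph.sym G 1~0 ◅ ε
  (suc zero) zero       → 1~0 ◅ ε
  (suc zero) (suc zero) → ε

-- Leastness and the case `∞` are contravariant in the predicate, so a converse implication is
-- required as well.
isSmallest-resp : {P Q : ℕ → Set} → (∀ t → P t → Q t) → (∀ t → Q t → P t) →
  ∀ x → IsSmallest P x → IsSmallest Q x
isSmallest-resp P⇒Q Q⇒P [ t ] (Pt , least) = P⇒Q t Pt , λ s Qs → least s (Q⇒P s Qs)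
isSmallest-resp P⇒Q Q⇒P ∞     never        = λ t Qt → never t (Q⇒P t Qt)

theorem3p1 : ∀ (n : ℕ) (G : SimpleGraph n) →
    3 ≤ n ⊎ (n ≡ 2 × ¬ Connected G) →
    ∀ (x : ℕ∞) → IsSingularPebblingNumber G x ⇔ IsPebblingNumber G x
theorem3p1 n G size x = mk⇔ (isSmallest-resp ⇐ (⇒ size) x) (isSmallest-resp (⇒ size) ⇐ x)
  where
  ⇐ : ∀ t → SinglySolves G t → Solves G t
  ⇐ t = singlySolves⇒solves G
  ⇒ : 3 ≤ n ⊎ (n ≡ 2 × ¬ Connected G) → ∀ t → Solves G t → SinglySolves G t
  ⇒ (inj₁ (s≤s (s≤s (s≤s _)))) t solves =
    solves⇒singlySolves G solves (¬solves-two G) another-vertex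
  -- No `t` solves the disconnected graph on two vertices, so the implication holds vacuously.
  ⇒ (inj₂ (refl , disconnected)) t solves =
    contradiction (solves⇒connected G solves) disconnected
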